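{- For every positive integer $k$ and every positive integer $n$, we have $$ex^{*}(n, P_{k+1}) < \left(\frac{9k}{7}+2\right)n.$$
   Context: For an integer $k$, $P_k$ denotes a path of length $k$, i.e. with $k$ edges. An edge-colored graph is rainbow if all its edges have different colors. For a graph $F$, the rainbow Turán number $ex^{*}(n,F)$ is the maximum number of edges in a graph on $n$ vertices that has a proper edge-coloring containing no rainbow copy of $F$. -}

module Defs where

open import Data.Nat using (ℕ; zero; suc; _+_; _<ᵇ_)
open import Data.Bool using (Bool; true; false; _∧_; if_then_else_)
open import Data.Fin using (Fin; toℕ; inject₁) renaming (suc to fsuc)
open import Data.List using (List; map; allFin)
open import Data.Nat.ListAction using (sum)
open import Data.Product using (Σ; _×_)
open import Relation.Binary.PropositionalEquality using (_≡_; _≢_)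
open import Relation.Nullary using (¬_)
open import Data.Empty using (⊥)

record Graph (n : ℕ) : Set where
  field
    adj   : Fin n → Fin n → Bool
    sym   : ∀ u v → adj u v ≡ adj v u
    irrefl : ∀ v → adj v v ≡ false

open Graph public

E : ∀ {n} → Graph n → Fin n → Fin n → Set
E G u v = adj G u v ≡ true

edgeCount : ∀ {n} → Graph n → ℕ
edgeCount {n} G =
  sum (map (λ u → sum (map (λ v → if (adj G u v ∧ (toℕ u <ᵇ toℕ v)) then 1 else 0)
                           (allFin n)))
           (allFin n))

record ProperColoring {n : ℕ} (G : Graph n) : Set where
  field
    col      : Fin n → Fin n → ℕ
    col-sym  : ∀ u v → E G u v → col u v ≡ col v u
    proper   : ∀ v a b → E G v a → E G v b → a ≢ b → col v a ≢ col v b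

open ProperColoring public

-- A copy of the path P_m (m edges, m+1 distinct vertices) in G.
record PathCopy {n : ℕ} (G : Graph n) (m : ℕ) : Set where
  field
    vtx      : Fin (suc m) → Fin n
    injective : ∀ i j → vtx i ≡ vtx j → i ≡ j
    edges    : ∀ (i : Fin m) → E G (vtx (inject₁ i)) (vtx (fsuc i))

open PathCopy public

pathEdgeColor : ∀ {n m} {G : Graph n} → ProperColoring G → PathCopy G m → Fin m → ℕ
pathEdgeColor c P i = col c (vtx P (inject₁ i)) (vtx P (fsuc i))

Rainbow : ∀ {n m} {G : Graph n} → ProperColoring G → PathCopy G m → Set
Rainbow c P = ∀ i j → pathEdgeColor c P i ≡ pathEdgeColor c P j → i ≡ j

NoRainbowPath : ∀ {n} {G : Graph n} → ProperColoring G → ℕ → Set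
NoRainbowPath {G = G} c m = (P : PathCopy G m) → ¬ Rainbow c P

module Submission where

open import Defs
open import Data.Nat using (ℕ; suc; _+_; _*_; _<_; _≤_)
open import Data.Nat using (zero; _∸_; z≤n; s≤s; _<ᵇ_; _<?_; _≤?_; _≟_; >-nonZero)
open import Data.Nat.Properties
open import Data.Nat.ListAction using (sum)
open import Data.Nat.Tactic.RingSolver using (solve-∀)
open import Data.Bool using (true; false; _∧_; if_then_else_) renaming (T to IsTrue)
import Data.Bool.Properties as Bool
open import Data.Fin using (Fin; toℕ)
import Data.Fin.Properties as Fin
open import Data.List using (List; []; _∷_; map; length; allFin; upTo)
open import Data.List.Properties using (length-upTo; length-tabulate)
open import Data.List.Membership.Propositional using (_∈_)
open import Data.List.Membership.Propositional.Properties using (∈-upTo⁺; ∈-upTo⁻; ∈-allFin)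
open import Data.List.Relation.Unary.All using (lookup)
open import Data.List.Relation.Unary.AllPairs using ([]; _∷_)
open import Data.List.Relation.Unary.Any using (here; there)
open import Data.List.Relation.Unary.Unique.Propositional using (Unique)
open import Data.List.Relation.Unary.Unique.Propositional.Properties using (upTo⁺; allFin⁺)
open import Data.Empty using (⊥; ⊥-elim)
open import Data.Product using (∃; _×_; _,_; proj₁; proj₂)
open import Data.Sum using (_⊎_; inj₁; inj₂)
open import Function using (_∘_)
open import Relation.Nullary using (¬_; Dec; yes; no; contradiction; ¬?)
open import Relation.Nullary.Decidable using (_×-dec_)
open import Relation.Binary.Definitions using (DecidableEquality; tri<; tri≈; tri>)
open import Relation.Binary.PropositionalEquality as ≡ using (_≡_; _≢_; refl; cong; cong₂; subst)

-- Pass to a smallest vertex set W with at least 9k/7 + 2 edges per vertex: every T ⊆ W then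
-- meets at least (9k/7 + 2)|T| edges. Decreasing k if necessary, W contains a rainbow path
-- P = v₀…vₖ, but no longer one. Call v₀vⱼ₊₁ a chord if its colour does not occur on P; each
-- chord yields the rainbow path vⱼ…v₀vⱼ₊₁…vₖ, which avoids the colour of vⱼvⱼ₊₁, so that
-- no edge from vₖ to the outside of P has that colour. Let ℓ be the number of chords and L the
-- set of the new starting points vⱼ. At most k edges at v₀ are not chords, so ℓ is large.
-- Applying the same to the chords of the new paths and using that L meets many edges, one
-- finds that more colours are avoided: vₖ has at most (8k − 35)/14 outside neighbours,
-- and the same holds for each vertex of L. If ℓ is maximal among all rainbow paths with k edges,
-- every vertex of L also has degree at most k + ℓ, and then L meets too few edges.

-- Indicators of decidable statements and finite sums.

⟦_⟧ : {P : Set} → Dec P → ℕ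
⟦ yes _ ⟧ = 1
⟦ no  _ ⟧ = 0

⟦⟧≤1 : {P : Set} (d : Dec P) → ⟦ d ⟧ ≤ 1
⟦⟧≤1 (yes _) = ≤-refl
⟦⟧≤1 (no  _) = z≤n

⟦⟧≡1 : {P : Set} (d : Dec P) → P → ⟦ d ⟧ ≡ 1
⟦⟧≡1 (yes _) _ = refl
⟦⟧≡1 (no ¬p) p = contradiction p ¬p

⟦⟧≡0 : {P : Set} (d : Dec P) → ¬ P → ⟦ d ⟧ ≡ 0
⟦⟧≡0 (yes p) ¬p = contradiction p ¬p
⟦⟧≡0 (no _)  _  = refl

≤1-* : ∀ {w a b} → w ≤ 1 → (w ≡ 1 → a ≤ b) → w * a ≤ b
≤1-* {zero}      _         _ = z≤n
≤1-* {suc zero} {a} _      h = ≤-trans (≤-reflexive (*-identityˡ a)) (h refl)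
≤1-* {suc (suc _)} (s≤s ()) _

⟦⟧-≤ : ∀ {P : Set} {b} (d : Dec P) → (P → 1 ≤ b) → ⟦ d ⟧ ≤ b
⟦⟧-≤ (yes p) h = h p
⟦⟧-≤ (no  _) _ = z≤n

1≤⟦⟧ : {P : Set} (d : Dec P) → 1 ≤ ⟦ d ⟧ → P
1≤⟦⟧ (yes p) _ = p

∑ : {A : Set} → List A → (A → ℕ) → ℕ
∑ xs f = sum (map f xs)

module _ {A : Set} where

  ∑-mono : ∀ (xs : List A) {f g} → (∀ {x} → x ∈ xs → f x ≤ g x) → ∑ xs f ≤ ∑ xs g
  ∑-mono []       h = z≤n
  ∑-mono (x ∷ xs) h = +-mono-≤ (h (here refl)) (∑-mono xs (h ∘ there))

  ∑-cong : ∀ (xs : List A) {f g} → (∀ x → f x ≡ g x) → ∑ xs f ≡ ∑ xs g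
  ∑-cong []       h = refl
  ∑-cong (x ∷ xs) h = cong₂ _+_ (h x) (∑-cong xs h)

  ∑-+ : ∀ (xs : List A) f g → ∑ xs (λ x → f x + g x) ≡ ∑ xs f + ∑ xs g
  ∑-+ []       f g = refl
  ∑-+ (x ∷ xs) f g rewrite ∑-+ xs f g = interchange (f x) (g x) (∑ xs f) (∑ xs g)
    where
    interchange : ∀ a b c d → (a + b) + (c + d) ≡ (a + c) + (b + d)
    interchange = solve-∀

  ∑-*ˡ : ∀ (xs : List A) a f → ∑ xs (λ x → a * f x) ≡ a * ∑ xs f
  ∑-*ˡ []       a f = ≡.sym (*-zeroʳ a)
  ∑-*ˡ (x ∷ xs) a f rewrite ∑-*ˡ xs a f = ≡.sym (*-distribˡ-+ a (f x) (∑ xs f))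

  ∑-*ʳ : ∀ (xs : List A) a f → ∑ xs (λ x → f x * a) ≡ ∑ xs f * a
  ∑-*ʳ []       a f = refl
  ∑-*ʳ (x ∷ xs) a f rewrite ∑-*ʳ xs a f = ≡.sym (*-distribʳ-+ a (f x) (∑ xs f))

  ∑-const : ∀ (xs : List A) a → ∑ xs (λ _ → a) ≡ length xs * a
  ∑-const []       a = refl
  ∑-const (x ∷ xs) a = cong (a +_) (∑-const xs a)

  ∑-zero : ∀ (xs : List A) {f} → (∀ {x} → x ∈ xs → f x ≡ 0) → ∑ xs f ≡ 0
  ∑-zero []       h = refl
  ∑-zero (x ∷ xs) h rewrite h (here refl) = ∑-zero xs (h ∘ there)

  ∈-≤-∑ : ∀ {xs : List A} {f x} → x ∈ xs → f x ≤ ∑ xs f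
  ∈-≤-∑ (here refl) = m≤m+n _ _
  ∈-≤-∑ (there x∈) = ≤-trans (∈-≤-∑ x∈) (m≤n+m _ _)

  -- Used wherever a count is at most one by injectivity, such as that of the edges at a vertex with
  -- a given colour.
  ∑-≤1 : ∀ {xs : List A} {f} → Unique xs → (∀ x → f x ≤ 1) →
         (∀ {x y} → x ∈ xs → y ∈ xs → 1 ≤ f x → 1 ≤ f y → x ≡ y) → ∑ xs f ≤ 1
  ∑-≤1 {[]} _ _ _ = z≤n
  ∑-≤1 {x ∷ xs} {f} (x∉ ∷ u) f≤1 h with f x in eq
  ... | zero = ∑-≤1 u f≤1 (λ p q → h (there p) (there q))
  ... | suc k = ≤-trans (≤-reflexive (≡.trans (cong (suc k +_) (∑-zero xs rest)) (+-identityʳ (suc k))))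
                        (subst (_≤ 1) eq (f≤1 x))
    where
    rest : ∀ {y} → y ∈ xs → f y ≡ 0
    rest {y} y∈ with f y in eq′
    ... | zero = refl
    ... | suc _ = contradiction
      (h (here refl) (there y∈) (subst (1 ≤_) (≡.sym eq) (s≤s z≤n)) (subst (1 ≤_) (≡.sym eq′) (s≤s z≤n)))
      (lookup x∉ y∈)

  ∑-δ : ∀ (_≟′_ : DecidableEquality A) {xs v} → Unique xs → v ∈ xs → ∀ (F : A → ℕ) →
        ∑ xs (λ u → ⟦ v ≟′ u ⟧ * F u) ≡ F v
  ∑-δ _≟′_ {x ∷ xs} (x∉ ∷ _) (here refl) F
    rewrite ⟦⟧≡1 (x ≟′ x) refl
          | ∑-zero xs {λ u → ⟦ x ≟′ u ⟧ * F u}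
              (λ {u} u∈ → cong (_* F u) (⟦⟧≡0 (x ≟′ u) (lookup x∉ u∈))) =
    ≡.trans (+-identityʳ _) (+-identityʳ _)
  ∑-δ _≟′_ {x ∷ xs} {v} (x∉ ∷ u) (there v∈) F
    rewrite ⟦⟧≡0 (v ≟′ x) (λ v≡x → lookup x∉ v∈ (≡.sym v≡x)) = ∑-δ _≟′_ u v∈ F

∑-swap : ∀ {A B : Set} (xs : List A) (ys : List B) (f : A → B → ℕ) →
         ∑ xs (λ x → ∑ ys (f x)) ≡ ∑ ys (λ y → ∑ xs (λ x → f x y))
∑-swap []       ys f = ≡.sym (∑-zero ys (λ _ → refl))
∑-swap (x ∷ xs) ys f rewrite ∑-swap xs ys f = ≡.sym (∑-+ ys (f x) _)

⟦⟧-*-mono : ∀ {P : Set} {a b} (d : Dec P) → (P → a ≤ b) → ⟦ d ⟧ * a ≤ ⟦ d ⟧ * b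
⟦⟧-*-mono (yes p) h = *-monoʳ-≤ 1 (h p)
⟦⟧-*-mono (no  _) _ = z≤n

1≤*ˡ : ∀ a b → 1 ≤ a * b → 1 ≤ a
1≤*ˡ (suc a) b _ = s≤s z≤n

1≤*ʳ : ∀ a b → 1 ≤ a * b → 1 ≤ b
1≤*ʳ a b h = 1≤*ˡ b a (subst (1 ≤_) (*-comm a b) h)

≱1⇒≡0 : ∀ {m} → ¬ 1 ≤ m → m ≡ 0
≱1⇒≡0 = n<1⇒n≡0 ∘ ≰⇒>

∑-pos : ∀ {A : Set} (xs : List A) {f} → 1 ≤ ∑ xs f → ∃ λ x → x ∈ xs × 1 ≤ f x
∑-pos (x ∷ xs) {f} h with f x in eq
... | suc _ = x , here refl , ≤-trans (s≤s z≤n) (≤-reflexive (≡.sym eq))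
... | zero with y , y∈ , p ← ∑-pos xs h = y , there y∈ , p

-- Each `F (σ x)` is expanded over all of `xs` by `∑-δ`; after the sums are swapped, injectivity of
-- `σ` lets each entry be hit at most once.
∑-∘-≤ : ∀ {A : Set} (_≟′_ : DecidableEquality A) {xs : List A} (σ : A → A) (F : A → ℕ) → Unique xs →
        (∀ {x} → x ∈ xs → σ x ∈ xs) → (∀ {x y} → σ x ≡ σ y → x ≡ y) →
        ∑ xs (F ∘ σ) ≤ ∑ xs F
∑-∘-≤ _≟′_ {xs} σ F u σ∈ σ-inj = begin
  ∑ xs (λ x → F (σ x))                               ≤⟨ ∑-mono xs (λ x∈ → ≤-reflexive (≡.sym (∑-δ _≟′_ u (σ∈ x∈) F))) ⟩
  ∑ xs (λ x → ∑ xs (λ m → ⟦ σ x ≟′ m ⟧ * F m))        ≡⟨ ∑-swap xs xs _ ⟩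
  ∑ xs (λ m → ∑ xs (λ x → ⟦ σ x ≟′ m ⟧ * F m))        ≤⟨ ∑-mono xs (λ {m} _ → at-most-once m) ⟩
  ∑ xs F                                             ∎
  where
  open ≤-Reasoning
  at-most-once : ∀ m → ∑ xs (λ x → ⟦ σ x ≟′ m ⟧ * F m) ≤ F m
  at-most-once m = begin
    ∑ xs (λ x → ⟦ σ x ≟′ m ⟧ * F m)  ≡⟨ ∑-*ʳ xs (F m) _ ⟩
    ∑ xs (λ x → ⟦ σ x ≟′ m ⟧) * F m  ≤⟨ *-monoˡ-≤ (F m) (∑-≤1 u (λ x → ⟦⟧≤1 (σ x ≟′ m))
      (λ {x} {y} _ _ p q → σ-inj (≡.trans (1≤⟦⟧ (σ x ≟′ m) p) (≡.sym (1≤⟦⟧ (σ y ≟′ m) q))))) ⟩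
    1 * F m                          ≡⟨ *-identityˡ (F m) ⟩
    F m                              ∎

m∸n≡1+[m∸1+n] : ∀ {m n} → n < m → m ∸ n ≡ suc (m ∸ suc n)
m∸n≡1+[m∸1+n] {suc m} {n} (s≤s n≤m) = +-∸-assoc 1 n≤m

-- Rainbow paths, their extension and their rotation along chords.

module _ {n : ℕ} (G : Graph n) (c : ProperColoring G) where

  E? : ∀ x u → Dec (E G x u)
  E? x u = adj G x u Bool.≟ true

  E-sym : ∀ {x u} → E G x u → E G u x
  E-sym {x} {u} e = ≡.trans (sym G u x) e

  E-irrefl : ∀ {x} → ¬ E G x x
  E-irrefl {x} e with ≡.trans (≡.sym e) (irrefl G x)
  ... | ()

  col-inj : ∀ {x a b} → E G x a → E G x b → col c x a ≡ col c x b → a ≡ b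
  col-inj {x} {a} {b} ea eb eq with a Fin.≟ b
  ... | yes a≡b = a≡b
  ... | no  a≢b = contradiction eq (proper c x a b ea eb a≢b)

  module _ (W : Fin n → ℕ) where

    -- A rainbow path with k edges inside W; the values of at beyond k are junk.
    record RainbowPath (k : ℕ) : Set where
      field
        at   : ℕ → Fin n
        inj  : ∀ {i j} → i ≤ k → j ≤ k → at i ≡ at j → i ≡ j
        edge : ∀ {i} → i < k → E G (at i) (at (suc i))
        inW  : ∀ {i} → i ≤ k → W (at i) ≡ 1

      hue : ℕ → ℕ
      hue i = col c (at i) (at (suc i))

      field
        hue-inj : ∀ {i j} → i < k → j < k → hue i ≡ hue j → i ≡ j

      Fresh : ℕ → Set
      Fresh κ = ∀ {i} → i < k → κ ≢ hue i

      -- The index is shifted so that chord `j` is paired with the edge from `vⱼ` to `vⱼ₊₁` that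
      -- flipping removes. For `k > 0`, index 0 gives no chord, since that edge is the first one of
      -- the path.
      Chord : ℕ → Set
      Chord j = E G (at 0) (at (suc j)) × Fresh (col c (at 0) (at (suc j)))

      On : Fin n → Set
      On u = ∃ λ i → i < suc k × at i ≡ u

      fresh? : ∀ κ → Dec (Fresh κ)
      fresh? κ = allUpTo? (λ i → ¬? (κ ≟ hue i)) k

      chord? : ∀ j → Dec (Chord j)
      chord? j = E? (at 0) (at (suc j)) ×-dec fresh? (col c (at 0) (at (suc j)))

      on? : ∀ u → Dec (On u)
      on? u = anyUpTo? (λ i → at i Fin.≟ u) (suc k)

    open RainbowPath

    module _ {k : ℕ} (P : RainbowPath k) where

      extend : ∀ {u} → W u ≡ 1 → E G (at P k) u → ¬ On P u → Fresh P (col c (at P k) u) →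
               RainbowPath (suc k)
      extend {u} Wu e u∉P fresh = record
        { at = w ; inj = w-inj ; edge = w-edge ; inW = w-inW ; hue-inj = w-hue-inj }
        where
        w : ℕ → Fin n
        w p with p ≤? k
        ... | yes _ = at P p
        ... | no  _ = u

        w-old : ∀ {p} → p ≤ k → w p ≡ at P p
        w-old {p} p≤k with p ≤? k
        ... | yes _ = refl
        ... | no ¬p = contradiction p≤k ¬p

        w-new : w (suc k) ≡ u
        w-new with suc k ≤? k
        ... | yes p = contradiction p (<-irrefl refl)
        ... | no _ = refl

        old∨new : ∀ {p} → p ≤ suc k → p ≤ k ⊎ p ≡ suc k
        old∨new p≤ with m≤n⇒m<n∨m≡n p≤
        ... | inj₁ (s≤s p≤k) = inj₁ p≤k
        ... | inj₂ eq = inj₂ eq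

        w-inj : ∀ {i j} → i ≤ suc k → j ≤ suc k → w i ≡ w j → i ≡ j
        w-inj i≤ j≤ eq with old∨new i≤ | old∨new j≤
        ... | inj₁ i≤k | inj₁ j≤k = inj P i≤k j≤k (≡.trans (≡.sym (w-old i≤k)) (≡.trans eq (w-old j≤k)))
        ... | inj₁ i≤k | inj₂ refl =
          ⊥-elim (u∉P (_ , s≤s i≤k , ≡.trans (≡.sym (w-old i≤k)) (≡.trans eq w-new)))
        ... | inj₂ refl | inj₁ j≤k =
          ⊥-elim (u∉P (_ , s≤s j≤k , ≡.trans (≡.sym (w-old j≤k)) (≡.trans (≡.sym eq) w-new)))
        ... | inj₂ refl | inj₂ refl = refl

        w-edge : ∀ {i} → i < suc k → E G (w i) (w (suc i))
        w-edge (s≤s i≤k) with m≤n⇒m<n∨m≡n i≤k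
        ... | inj₁ i<k rewrite w-old i≤k | w-old i<k = edge P i<k
        ... | inj₂ refl rewrite w-old i≤k | w-new = e

        w-inW : ∀ {i} → i ≤ suc k → W (w i) ≡ 1
        w-inW i≤ with old∨new i≤
        ... | inj₁ i≤k rewrite w-old i≤k = inW P i≤k
        ... | inj₂ refl rewrite w-new = Wu

        hue-old : ∀ {i} → i < k → col c (w i) (w (suc i)) ≡ hue P i
        hue-old i<k = cong₂ (col c) (w-old (<⇒≤ i<k)) (w-old i<k)

        hue-new : col c (w k) (w (suc k)) ≡ col c (at P k) u
        hue-new = cong₂ (col c) (w-old ≤-refl) w-new

        w-hue-inj : ∀ {i j} → i < suc k → j < suc k →
                    col c (w i) (w (suc i)) ≡ col c (w j) (w (suc j)) → i ≡ j
        w-hue-inj (s≤s i≤k) (s≤s j≤k) eq with m≤n⇒m<n∨m≡n i≤k | m≤n⇒m<n∨m≡n j≤k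
        ... | inj₁ i<k | inj₁ j<k =
          hue-inj P i<k j<k (≡.trans (≡.sym (hue-old i<k)) (≡.trans eq (hue-old j<k)))
        ... | inj₁ i<k | inj₂ refl =
          ⊥-elim (fresh i<k (≡.trans (≡.sym hue-new) (≡.trans (≡.sym eq) (hue-old i<k))))
        ... | inj₂ refl | inj₁ j<k =
          ⊥-elim (fresh j<k (≡.trans (≡.sym hue-new) (≡.trans eq (hue-old j<k))))
        ... | inj₂ refl | inj₂ refl = refl

      -- Replacing the edge j by a chord from the start reverses the initial segment v₀…vⱼ;
      -- for j = k no chord is involved and the whole path is reversed.
      module Flip (j : ℕ) (j≤k : j ≤ k) (chord : j < k → Chord P j) where

        turn : ℕ → ℕ
        turn p with p ≤? j
        ... | yes _ = j ∸ p
        ... | no  _ = p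

        turn-lo : ∀ {p} → p ≤ j → turn p ≡ j ∸ p
        turn-lo {p} p≤j with p ≤? j
        ... | yes _ = refl
        ... | no ¬p = contradiction p≤j ¬p

        turn-hi : ∀ {p} → j < p → turn p ≡ p
        turn-hi {p} j<p with p ≤? j
        ... | yes p≤j = contradiction p≤j (<⇒≱ j<p)
        ... | no _ = refl

        turn-≤ : ∀ {p} → p ≤ k → turn p ≤ k
        turn-≤ {p} p≤k with p ≤? j
        ... | yes _ = ≤-trans (m∸n≤m j p) j≤k
        ... | no _ = p≤k

        -- As an involution `turn` is injective, so the vertices of the flipped path stay distinct.
        turn-turn : ∀ p → turn (turn p) ≡ p
        turn-turn p with p ≤? j
        ... | yes p≤j = ≡.trans (turn-lo (m∸n≤m j p)) (m∸[m∸n]≡n p≤j)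
        ... | no p≰j = turn-hi (≰⇒> p≰j)

        w : ℕ → Fin n
        w p = at P (turn p)

        w-edge : ∀ {i} → i < k → E G (w i) (w (suc i))
        w-edge {i} i<k with <-cmp i j
        ... | tri< i<j _ _ rewrite turn-lo (<⇒≤ i<j) | turn-lo i<j | m∸n≡1+[m∸1+n] i<j =
          E-sym (edge P (<-≤-trans (≤-trans (≤-reflexive (≡.sym (m∸n≡1+[m∸1+n] i<j))) (m∸n≤m j i)) j≤k))
        ... | tri≈ _ refl _ rewrite turn-lo {i} ≤-refl | turn-hi {suc i} ≤-refl | n∸n≡0 i =
          proj₁ (chord i<k)
        ... | tri> _ _ j<i rewrite turn-hi j<i | turn-hi (m<n⇒m<1+n j<i) = edge P i<k

        wHue : ℕ → ℕ
        wHue i = col c (w i) (w (suc i))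

        -- σ i is the edge of P traversed as the i-th edge of the flipped path, for i ≢ j.
        σ : ℕ → ℕ
        σ i with i <? j
        ... | yes _ = j ∸ suc i
        ... | no  _ = i

        σ-lo : ∀ {i} → i < j → σ i ≡ j ∸ suc i
        σ-lo {i} i<j with i <? j
        ... | yes _ = refl
        ... | no ¬p = contradiction i<j ¬p

        σ-hi : ∀ {i} → j ≤ i → σ i ≡ i
        σ-hi {i} j≤i with i <? j
        ... | yes i<j = contradiction j≤i (<⇒≱ i<j)
        ... | no _ = refl

        lo-< : ∀ {i} → i < j → j ∸ suc i < j
        lo-< {i} i<j = ≤-trans (≤-reflexive (≡.sym (m∸n≡1+[m∸1+n] i<j))) (m∸n≤m j i)

        σ-σ : ∀ i → σ (σ i) ≡ i
        σ-σ i with i <? j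
        ... | no i≮j = σ-hi (≮⇒≥ i≮j)
        ... | yes i<j = ≡.trans (σ-lo (lo-< i<j))
          (≡.trans (cong (j ∸_) (≡.sym (m∸n≡1+[m∸1+n] i<j))) (m∸[m∸n]≡n (<⇒≤ i<j)))

        σ-inj : ∀ {i i′} → σ i ≡ σ i′ → i ≡ i′
        σ-inj {i} {i′} eq = ≡.trans (≡.sym (σ-σ i)) (≡.trans (cong σ eq) (σ-σ i′))

        σ-< : ∀ {i} → i < k → σ i < k
        σ-< {i} i<k with i <? j
        ... | yes i<j = <-≤-trans (lo-< i<j) j≤k
        ... | no _ = i<k

        hue-lo : ∀ {i} → i < j → wHue i ≡ hue P (j ∸ suc i)
        hue-lo {i} i<j rewrite turn-lo (<⇒≤ i<j) | turn-lo i<j | m∸n≡1+[m∸1+n] i<j =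
          col-sym c _ _ (E-sym (edge P (<-≤-trans (lo-< i<j) j≤k)))

        hue-mid : wHue j ≡ col c (at P 0) (at P (suc j))
        hue-mid rewrite turn-lo {j} ≤-refl | turn-hi {suc j} ≤-refl | n∸n≡0 j = refl

        hue-hi : ∀ {i} → j < i → wHue i ≡ hue P i
        hue-hi j<i rewrite turn-hi j<i | turn-hi (m<n⇒m<1+n j<i) = refl

        hue-σ : ∀ {i} → i ≢ j → wHue i ≡ hue P (σ i)
        hue-σ {i} i≢j with <-cmp i j
        ... | tri< i<j _ _ = ≡.trans (hue-lo i<j) (cong (hue P) (≡.sym (σ-lo i<j)))
        ... | tri≈ _ i≡j _ = contradiction i≡j i≢j
        ... | tri> _ _ j<i = ≡.trans (hue-hi j<i) (cong (hue P) (≡.sym (σ-hi (<⇒≤ j<i))))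

        -- Away from position `j` the hues are those of `P` permuted by `σ`; the hue at `j` is that
        -- of the chord, which differs from all of them by freshness.
        w-hue-inj : ∀ {p q} → p < k → q < k → wHue p ≡ wHue q → p ≡ q
        w-hue-inj {p} {q} p<k q<k eq with p ≟ j | q ≟ j
        ... | yes refl | yes refl = refl
        ... | yes refl | no q≢j = ⊥-elim (proj₂ (chord p<k) (σ-< q<k)
          (≡.trans (≡.sym hue-mid) (≡.trans eq (hue-σ q≢j))))
        ... | no p≢j | yes refl = ⊥-elim (proj₂ (chord q<k) (σ-< p<k)
          (≡.trans (≡.sym hue-mid) (≡.trans (≡.sym eq) (hue-σ p≢j))))
        ... | no p≢j | no q≢j = σ-inj (hue-inj P (σ-< p<k) (σ-< q<k)
          (≡.trans (≡.sym (hue-σ p≢j)) (≡.trans eq (hue-σ q≢j))))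

        w-inj : ∀ {p q} → p ≤ k → q ≤ k → w p ≡ w q → p ≡ q
        w-inj {p} {q} p≤k q≤k eq = ≡.trans (≡.sym (turn-turn p))
          (≡.trans (cong turn (inj P (turn-≤ p≤k) (turn-≤ q≤k) eq)) (turn-turn q))

        flip : RainbowPath k
        flip = record
          { at = w ; inj = w-inj ; edge = w-edge
          ; inW = λ p≤k → inW P (turn-≤ p≤k) ; hue-inj = w-hue-inj }

        on-flip : ∀ {u} → On flip u → On P u
        on-flip (p , s≤s p≤k , eq) = turn p , s≤s (turn-≤ p≤k) , eq

        flip-start : at flip 0 ≡ at P j
        flip-start = cong (at P) (turn-lo z≤n)

        flip-end : j < k → at flip k ≡ at P k
        flip-end j<k = cong (at P) (turn-hi j<k)

        -- The hue of the removed edge no longer occurs on the flipped path.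
        freed : (j<k : j < k) → Fresh flip (hue P j)
        freed j<k {i} i<k eq with i ≟ j
        ... | yes refl = proj₂ (chord j<k) j<k (≡.trans (≡.sym hue-mid) (≡.sym eq))
        ... | no i≢j = i≢j (≡.trans (≡.sym (σ-σ i)) (≡.trans (cong σ σi≡j) (σ-hi ≤-refl)))
          where
          σi≡j : σ i ≡ j
          σi≡j = ≡.sym (hue-inj P j<k (σ-< i<k) (≡.trans eq (hue-σ i≢j)))

      module Rotate {j : ℕ} (j<k : j < k) (chord : Chord P j) = Flip j (<⇒≤ j<k) (λ _ → chord)

      module Reverse = Flip k ≤-refl (λ k<k → contradiction k<k (<-irrefl refl))

  -- Degrees and edge counts inside a vertex set.

  V : List (Fin n)
  V = allFin n

  α : Fin n → Fin n → ℕ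
  α x u = ⟦ E? x u ⟧

  α-sym : ∀ x u → α x u ≡ α u x
  α-sym x u with E? x u
  ... | yes e = ≡.sym (⟦⟧≡1 (E? u x) (E-sym e))
  ... | no ¬e = ≡.sym (⟦⟧≡0 (E? u x) (¬e ∘ E-sym))

  deg : (Fin n → ℕ) → Fin n → ℕ
  deg W x = ∑ V (λ u → W u * α x u)

  -- For an indicator function W, twice the number of edges inside W.
  e₂ : (Fin n → ℕ) → ℕ
  e₂ W = ∑ V (λ x → W x * deg W x)

  -- Chords at the start and outside edges at the end of a longest rainbow path.

  module _ (W : Fin n → ℕ) (W≤1 : ∀ u → W u ≤ 1)
           (k : ℕ) (maximal : ¬ RainbowPath W (suc k)) where

    Path : Set
    Path = RainbowPath W k

    open RainbowPath

    I : List ℕ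
    I = upTo k

    ∑1≡k : ∑ I (λ _ → 1) ≡ k
    ∑1≡k = ≡.trans (∑-const I 1) (≡.trans (*-identityʳ _) (length-upTo k))

    -- Read by position, `ν P` is also the indicator of the set `L` of new starting points: chord
    -- `j` contributes `vⱼ`.
    ν : Path → ℕ → ℕ
    ν P j = ⟦ chord? P j ⟧

    ℓ : Path → ℕ
    ℓ P = ∑ I (ν P)

    -- Edges from the last vertex of P to vertices off P; ω P j counts those with the hue of edge j.
    out : Path → Fin n → ℕ
    out P u = W u * (α (at P k) u * ⟦ ¬? (on? P u) ⟧)

    outdeg : Path → ℕ
    outdeg P = ∑ V (out P)

    ω : Path → ℕ → ℕ
    ω P j = ∑ V (λ u → out P u * ⟦ col c (at P k) u ≟ hue P j ⟧)

    W≡1 : ∀ {u} → 1 ≤ W u → W u ≡ 1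
    W≡1 p = ≤-antisym (W≤1 _) p

    out⇒ : ∀ P {u} → 1 ≤ out P u → W u ≡ 1 × E G (at P k) u × ¬ On P u
    out⇒ P {u} h = W≡1 (1≤*ˡ (W u) _ h) , 1≤⟦⟧ (E? (at P k) u) (1≤*ˡ (α (at P k) u) _ h′)
                 , 1≤⟦⟧ (¬? (on? P u)) (1≤*ʳ (α (at P k) u) _ h′)
      where h′ = 1≤*ʳ (W u) _ h

    hue? : ∀ (P : Path) κ → Dec (∃ λ i → i < k × κ ≡ hue P i)
    hue? P κ = anyUpTo? (λ i → κ ≟ hue P i) k

    out-≤1 : ∀ P u → out P u ≤ 1
    out-≤1 P u = *-mono-≤ (W≤1 u) (*-mono-≤ (⟦⟧≤1 (E? (at P k) u)) (⟦⟧≤1 (¬? (on? P u))))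

    -- An outside edge with a colour not on `P` would extend `P` to `k + 1` edges, so every outside
    -- edge is counted under the hue that it repeats.
    outdeg≤∑ω : ∀ P → outdeg P ≤ ∑ I (ω P)
    outdeg≤∑ω P = ≤-trans (∑-mono V (λ {u} _ → has-hue u)) (≤-reflexive (∑-swap V I _))
      where
      term : Fin n → ℕ → ℕ
      term u j = out P u * ⟦ col c (at P k) u ≟ hue P j ⟧
      has-hue : ∀ u → out P u ≤ ∑ I (term u)
      has-hue u with 1 ≤? out P u
      ... | no ¬p = ≤-trans (≤-reflexive (≱1⇒≡0 ¬p)) z≤n
      ... | yes p with Wu , e , u∉P ← out⇒ P p with hue? P (col c (at P k) u)
      ...   | no ¬q = ⊥-elim (maximal (extend W P Wu e u∉P λ i<k eq → ¬q (_ , i<k , eq)))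
      ...   | yes (i , i<k , eq) = ≤-trans
        (≤-reflexive (≡.sym (≡.trans (cong (out P u *_) (⟦⟧≡1 (_ ≟ _) eq)) (*-identityʳ _))))
        (∈-≤-∑ {f = term u} (∈-upTo⁺ i<k))

    -- A hue missing on some rainbow path with the same last vertex is not the hue of an
    -- edge from that vertex to the outside.
    ω-vanishes : ∀ (P S : Path) {m} → at S k ≡ at P k → (∀ {u} → On S u → On P u) →
                 Fresh S (hue P m) → ω P m ≡ 0
    ω-vanishes P S {m} end on fresh = ∑-zero V (λ {u} _ → ≱1⇒≡0 (absurd u))
      where
      absurd : ∀ u → ¬ 1 ≤ out P u * ⟦ col c (at P k) u ≟ hue P m ⟧
      absurd u h with Wu , e , u∉P ← out⇒ P (1≤*ˡ (out P u) _ h)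
        = maximal (extend W S Wu (subst (λ y → E G y u) (≡.sym end) e) (u∉P ∘ on)
            (subst (Fresh S) (≡.trans (≡.sym (1≤⟦⟧ (_ ≟ _) (1≤*ʳ (out P u) _ h)))
              (cong (λ y → col c y u) (≡.sym end))) fresh))

    ω≤1 : ∀ P j → ω P j ≤ 1
    ω≤1 P j = ∑-≤1 (allFin⁺ n) (λ u → *-mono-≤ (out-≤1 P u) (⟦⟧≤1 (_ ≟ hue P j)))
      λ {x} {y} _ _ p q → col-inj
        (proj₁ (proj₂ (out⇒ P (1≤*ˡ (out P x) _ p)))) (proj₁ (proj₂ (out⇒ P (1≤*ˡ (out P y) _ q))))
        (≡.trans (1≤⟦⟧ (_ ≟ _) (1≤*ʳ (out P x) _ p)) (≡.sym (1≤⟦⟧ (_ ≟ _) (1≤*ʳ (out P y) _ q))))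

    -- The path flipped along chord `j` keeps the last vertex and stays on the vertices of `P`, but
    -- lacks hue `j`; an outside edge of that hue would extend it.
    ν+ω≤1 : ∀ P {j} → j < k → ν P j + ω P j ≤ 1
    ν+ω≤1 P {j} j<k with chord? P j
    ... | no _ = ω≤1 P j
    ... | yes ch = ≤-reflexive (cong suc (ω-vanishes P F.flip (F.flip-end j<k) F.on-flip (F.freed j<k)))
      where module F = Rotate W P j<k ch

    -- An edge at `v₀` inside `W` repeats one of the `k` hues, each possible only once, or is fresh.
    -- A fresh one ends on `P`, since otherwise it would extend the reversed path, and is then a
    -- chord.
    deg-start : ∀ P → deg W (at P 0) ≤ k + ℓ P
    deg-start P = begin
      deg W v₀                                          ≤⟨ ∑-mono V (λ {u} _ → pointwise u) ⟩
      ∑ V (λ u → ∑ I (old u) + ∑ I (new u))             ≡⟨ ∑-+ V _ _ ⟩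
      ∑ V (λ u → ∑ I (old u)) + ∑ V (λ u → ∑ I (new u)) ≡⟨ cong₂ _+_ (∑-swap V I old) (∑-swap V I new) ⟩
      ∑ I (λ j → ∑ V (λ u → old u j)) + ∑ I (λ j → ∑ V (λ u → new u j))
        ≤⟨ +-mono-≤ (∑-mono I (λ {j} _ → old-≤1 j)) (∑-mono I (λ {j} _ → new-≤ν j)) ⟩
      ∑ I (λ _ → 1) + ℓ P                               ≡⟨ cong (_+ ℓ P) ∑1≡k ⟩
      k + ℓ P                                           ∎
      where
      open ≤-Reasoning
      v₀ = at P 0
      old new : Fin n → ℕ → ℕ
      old u j = α v₀ u * ⟦ col c v₀ u ≟ hue P j ⟧
      new u j = ν P j * ⟦ at P (suc j) Fin.≟ u ⟧

      old-≤1 : ∀ j → ∑ V (λ u → old u j) ≤ 1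
      old-≤1 j = ∑-≤1 (allFin⁺ n) (λ u → *-mono-≤ (⟦⟧≤1 (E? v₀ u)) (⟦⟧≤1 (_ ≟ hue P j)))
        λ {x} {y} _ _ p q → col-inj
          (1≤⟦⟧ (E? v₀ x) (1≤*ˡ (α v₀ x) _ p)) (1≤⟦⟧ (E? v₀ y) (1≤*ˡ (α v₀ y) _ q))
          (≡.trans (1≤⟦⟧ (_ ≟ _) (1≤*ʳ (α v₀ x) _ p)) (≡.sym (1≤⟦⟧ (_ ≟ _) (1≤*ʳ (α v₀ y) _ q))))

      new-≤ν : ∀ j → ∑ V (λ u → new u j) ≤ ν P j
      new-≤ν j = begin
        ∑ V (λ u → new u j)                          ≡⟨ ∑-*ˡ V (ν P j) _ ⟩
        ν P j * ∑ V (λ u → ⟦ at P (suc j) Fin.≟ u ⟧) ≤⟨ *-monoʳ-≤ (ν P j) (∑-≤1 (allFin⁺ n) (λ u → ⟦⟧≤1 (_ Fin.≟ u))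
          λ {x} {y} _ _ p q → ≡.trans (≡.sym (1≤⟦⟧ (_ Fin.≟ _) p)) (1≤⟦⟧ (_ Fin.≟ _) q)) ⟩
        ν P j * 1                                    ≡⟨ *-identityʳ _ ⟩
        ν P j                                        ∎

      covered : ∀ u → W u ≡ 1 → E G v₀ u → 1 ≤ ∑ I (old u) + ∑ I (new u)
      covered u Wu e with hue? P (col c v₀ u)
      ... | yes (i , i<k , eq) = ≤-trans
        (≤-reflexive (≡.sym (cong₂ _*_ (⟦⟧≡1 (E? v₀ u) e) (⟦⟧≡1 (_ ≟ _) eq))))
        (≤-trans (∈-≤-∑ {f = old u} (∈-upTo⁺ i<k)) (m≤m+n _ _))
      ... | no ¬q with on? P u
      ...   | yes (zero , _ , refl) = contradiction e (E-irrefl)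
      ...   | yes (suc i , s≤s i<k , refl) = ≤-trans
        (≤-reflexive (≡.sym (cong₂ _*_ (⟦⟧≡1 (chord? P i) (e , λ p eq → ¬q (_ , p , eq))) (⟦⟧≡1 (_ Fin.≟ _) refl))))
        (≤-trans (∈-≤-∑ {f = new u} (∈-upTo⁺ i<k)) (m≤n+m _ _))
      ...   | no u∉P = ⊥-elim (maximal (extend W R.flip Wu (subst (λ y → E G y u) (≡.sym end) e) (u∉P ∘ R.on-flip)
              λ {i} i<k eq → ¬q (_ , R.σ-< i<k , ≡.trans (cong (λ y → col c y u) (≡.sym end)) (≡.trans eq (R.hue-σ (<⇒≢ i<k))))))
        where
        module R = Reverse W P
        end : at R.flip k ≡ v₀
        end = cong (at P) (≡.trans (R.turn-lo ≤-refl) (n∸n≡0 k))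

      pointwise : ∀ u → W u * α v₀ u ≤ ∑ I (old u) + ∑ I (new u)
      pointwise u = ≤1-* (W≤1 u) λ Wu → ⟦⟧-≤ (E? v₀ u) (covered u Wu)

    -- Edges of P whose hue is neither freed by a chord nor the hue of an outside edge.
    γ : Path → ℕ → ℕ
    γ P m = 1 ∸ (ν P m + ω P m)

    -- By `ν+ω≤1` the truncated subtraction in `γ` loses nothing, so each of the `k` edges is
    -- counted exactly once.
    ∑ν+ω+γ : ∀ P → ℓ P + ∑ I (ω P) + ∑ I (γ P) ≤ k
    ∑ν+ω+γ P = begin
      ℓ P + ∑ I (ω P) + ∑ I (γ P)            ≡⟨ cong (_+ ∑ I (γ P)) (∑-+ I _ _) ⟨
      ∑ I (λ j → ν P j + ω P j) + ∑ I (γ P)  ≡⟨ ∑-+ I _ _ ⟨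
      ∑ I (λ j → ν P j + ω P j + γ P j)
        ≤⟨ ∑-mono I (λ j∈ → ≤-reflexive (m+[n∸m]≡n (ν+ω≤1 P (∈-upTo⁻ j∈)))) ⟩
      ∑ I (λ _ → 1)                          ≡⟨ ∑1≡k ⟩
      k                                      ∎
      where open ≤-Reasoning

    -- Flipping at j reverses the edges before j. A chord of the flipped path freeing the hue
    -- of an edge m < j joins vⱼ to vₘ itself, which is what makes L induce many edges.
    κ : Path → ℕ → ℕ → ℕ
    κ P j m with m <? j
    ... | yes _ = α (at P j) (at P m)
    ... | no  _ = 1

    κ-lo : ∀ P {j m} → m < j → κ P j m ≡ α (at P j) (at P m)
    κ-lo P {j} {m} m<j with m <? j
    ... | yes _ = refl
    ... | no ¬p = contradiction m<j ¬p

    κ-hi : ∀ P {j m} → j ≤ m → κ P j m ≡ 1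
    κ-hi P {j} {m} j≤m with m <? j
    ... | yes m<j = contradiction j≤m (<⇒≱ m<j)
    ... | no _ = refl

    -- Chord `p` of the flipped path is charged injectively to the edge `σ p` of `P`. For `p ≢ j` a
    -- second flip frees the hue of that edge while `vₖ` stays last, so `ω` vanishes there and the
    -- edge is counted by `ν` or by `γ`.
    ℓ-flipped : ∀ P {j} (j<k : j < k) (ch : Chord P j) →
                ℓ (Rotate.flip W P j<k ch) ≤ ∑ I (λ m → κ P j m * ν P m) + ∑ I (γ P)
    ℓ-flipped P {j} j<k ch = begin
      ∑ I (ν Q)                                        ≤⟨ ∑-mono I (λ {p} p∈ → ⟦⟧-≤ (chord? Q p) (bound (∈-upTo⁻ p∈))) ⟩
      ∑ I (λ p → F (J.σ p))                            ≤⟨ ∑-∘-≤ _≟_ J.σ F (upTo⁺ k) (∈-upTo⁺ ∘ J.σ-< ∘ ∈-upTo⁻) J.σ-inj ⟩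
      ∑ I F                                            ≡⟨ ∑-+ I _ _ ⟩
      ∑ I (λ m → κ P j m * ν P m) + ∑ I (γ P)          ∎
      where
      open ≤-Reasoning
      module J = Rotate W P j<k ch
      Q = J.flip
      F : ℕ → ℕ
      F m = κ P j m * ν P m + γ P m

      positive : ∀ {m} → κ P j m ≡ 1 → ω P m ≡ 0 → 1 ≤ F m
      positive {m} κ≡1 ω≡0 rewrite κ≡1 | ω≡0 | *-identityˡ (ν P m) = m≤n+m∸n 1 (ν P m)

      module _ {p : ℕ} (p<k : p < k) (ch′ : Chord Q p) where
        module K = Rotate W Q p<k ch′

        no-out : p ≢ j → ω P (J.σ p) ≡ 0
        no-out p≢j = ω-vanishes P K.flip (≡.trans (K.flip-end p<k) (J.flip-end j<k)) (J.on-flip ∘ K.on-flip)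
          (subst (Fresh K.flip) (J.hue-σ p≢j) (K.freed p<k))

        bound : 1 ≤ F (J.σ p)
        bound with <-cmp p j
        ... | tri< p<j p≢j _ = positive
          (≡.trans (cong (κ P j) (J.σ-lo p<j)) (≡.trans (κ-lo P (J.lo-< p<j)) (⟦⟧≡1 (E? _ _) adjacent)))
          (no-out p≢j)
          where
          -- The chord ends at position `p + 1` of the flipped path, which is vertex `j ∸ suc p` of
          -- `P`: the index `σ p` again.
          adjacent : E G (at P j) (at P (j ∸ suc p))
          adjacent = subst (λ x → E G x (at P (j ∸ suc p))) J.flip-start
            (subst (E G (at Q 0)) (cong (at P) (J.turn-lo p<j)) (proj₁ ch′))
        -- Position `j` of the flipped path carries the hue of the chord, so `no-out` does not
        -- apply; chord `j` of `P` itself supplies `ν P j ≡ 1`.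
        ... | tri≈ _ refl _ rewrite J.σ-hi {p} ≤-refl | κ-hi P {p} ≤-refl | ⟦⟧≡1 (chord? P p) ch = s≤s z≤n
        ... | tri> _ p≢j j<p = positive (≡.trans (cong (κ P j) (J.σ-hi (<⇒≤ j<p))) (κ-hi P (<⇒≤ j<p))) (no-out p≢j)

    -- Sum of F over L; inner P is then twice the number of edges inside L.
    S : Path → (Fin n → ℕ) → ℕ
    S P F = ∑ I (λ j → ν P j * F (at P j))

    inner : Path → ℕ
    inner P = S P (λ x → S P (α x))

    -- Summed over ordered pairs from `L`, `κ P j m + κ P m j` is at most the adjacency plus 1, with
    -- 1 more on the diagonal. The three terms contribute `inner P`, the square of `ℓ P` and `ℓ P`.
    chord-pairs : ∀ P → 2 * ∑ I (λ j → ν P j * ∑ I (λ m → κ P j m * ν P m)) ≤ inner P + (ℓ P * ℓ P + ℓ P)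
    chord-pairs P = begin
      2 * ∑ I (λ j → ν P j * ∑ I (λ m → κ P j m * ν P m)) ≡⟨ cong (2 *_) (∑-cong I λ j → ≡.sym (∑-*ˡ I (ν P j) _)) ⟩
      2 * ∑ I (λ j → ∑ I (λ m → f j m))                ≡⟨ double (∑ I (λ j → ∑ I (λ m → f j m))) ⟩
      ∑ I (λ j → ∑ I (λ m → f j m)) + ∑ I (λ j → ∑ I (λ m → f j m))
        ≡⟨ cong (∑ I (λ j → ∑ I (λ m → f j m)) +_) (∑-swap I I f) ⟩
      ∑ I (λ j → ∑ I (λ m → f j m)) + ∑ I (λ j → ∑ I (λ m → f m j)) ≡⟨ ∑-+ I _ _ ⟨
      ∑ I (λ j → ∑ I (λ m → f j m) + ∑ I (λ m → f m j)) ≤⟨ ∑-mono I (λ {j} j∈ → row j∈) ⟩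
      ∑ I (λ j → ν P j * S P (α (at P j)) + ν P j * (ℓ P + 1)) ≡⟨ ∑-+ I _ _ ⟩
      inner P + ∑ I (λ j → ν P j * (ℓ P + 1))          ≡⟨ cong (inner P +_) (∑-*ʳ I (ℓ P + 1) (ν P)) ⟩
      inner P + ℓ P * (ℓ P + 1)                        ≡⟨ cong (inner P +_) (expand (ℓ P)) ⟩
      inner P + (ℓ P * ℓ P + ℓ P)                      ∎
      where
      open ≤-Reasoning
      double : ∀ a → 2 * a ≡ a + a
      double = solve-∀
      expand : ∀ a → a * (a + 1) ≡ a * a + a
      expand = solve-∀
      f : ℕ → ℕ → ℕ
      f j m = ν P j * (κ P j m * ν P m)

      κ+κ : ∀ j m → κ P j m + κ P m j ≤ α (at P j) (at P m) + 1 + ⟦ j ≟ m ⟧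
      κ+κ j m with <-cmp j m
      ... | tri< j<m _ _ rewrite κ-hi P (<⇒≤ j<m) | κ-lo P j<m | α-sym (at P m) (at P j) =
        ≤-trans (≤-reflexive (+-comm 1 _)) (m≤m+n _ _)
      ... | tri≈ _ refl _ rewrite κ-hi P {j} ≤-refl | ⟦⟧≡1 (j ≟ j) refl = ≤-trans (m≤n+m 2 _) (≤-reflexive (≡.sym (+-assoc _ 1 1)))
      ... | tri> _ _ m<j rewrite κ-hi P (<⇒≤ m<j) | κ-lo P m<j = m≤m+n _ _

      row : ∀ {j} → j ∈ I → ∑ I (λ m → f j m) + ∑ I (λ m → f m j) ≤ ν P j * S P (α (at P j)) + ν P j * (ℓ P + 1)
      row {j} j∈ = begin
        ∑ I (λ m → f j m) + ∑ I (λ m → f m j) ≡⟨ ∑-+ I _ _ ⟨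
        ∑ I (λ m → f j m + f m j)            ≡⟨ ∑-cong I (λ m → factor (ν P j) (κ P j m) (ν P m) (κ P m j)) ⟩
        ∑ I (λ m → ν P j * (ν P m * (κ P j m + κ P m j)))
          ≤⟨ ∑-mono I (λ {m} _ → *-monoʳ-≤ (ν P j) (*-monoʳ-≤ (ν P m) (κ+κ j m))) ⟩
        ∑ I (λ m → ν P j * (ν P m * (α (at P j) (at P m) + 1 + ⟦ j ≟ m ⟧))) ≡⟨ ∑-*ˡ I (ν P j) _ ⟩
        ν P j * ∑ I (λ m → ν P m * (α (at P j) (at P m) + 1 + ⟦ j ≟ m ⟧))
          ≡⟨ cong (ν P j *_) (∑-cong I λ m → split (ν P m) (α (at P j) (at P m)) ⟦ j ≟ m ⟧) ⟩
        ν P j * ∑ I (λ m → ν P m * α (at P j) (at P m) + ν P m + ⟦ j ≟ m ⟧ * ν P m)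
          ≡⟨ cong (ν P j *_) (≡.trans (∑-+ I _ _) (cong₂ _+_ (∑-+ I _ _) (∑-δ _≟_ (upTo⁺ k) j∈ (ν P)))) ⟩
        ν P j * (S P (α (at P j)) + ℓ P + ν P j)
          ≤⟨ *-monoʳ-≤ (ν P j) (+-monoʳ-≤ (S P (α (at P j)) + ℓ P) (⟦⟧≤1 (chord? P j))) ⟩
        ν P j * (S P (α (at P j)) + ℓ P + 1) ≡⟨ distrib (ν P j) (S P (α (at P j))) (ℓ P) ⟩
        ν P j * S P (α (at P j)) + ν P j * (ℓ P + 1) ∎
        where
        factor : ∀ a b d e → a * (b * d) + d * (e * a) ≡ a * (d * (b + e))
        factor = solve-∀
        split : ∀ a b d → a * (b + 1 + d) ≡ a * b + a + d * a
        split = solve-∀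
        distrib : ∀ a b d → a * (b + d + 1) ≡ a * b + a * (d + 1)
        distrib = solve-∀

    -- `vⱼ` is the start of the flipped path, so `deg-start` applies to it.
    flipped-degree : ∀ P {j} (j<k : j < k) (ch : Chord P j) →
                     deg W (at P j) ≤ k + ℓ (Rotate.flip W P j<k ch)
    flipped-degree P {j} j<k ch = ≤-trans (≤-reflexive (cong (deg W) (≡.sym J.flip-start))) (deg-start J.flip)
      where module J = Rotate W P j<k ch

    degree-sum : ∀ P → S P (deg W) ≤
                 ℓ P * k + ∑ I (λ j → ν P j * ∑ I (λ m → κ P j m * ν P m)) + ℓ P * ∑ I (γ P)
    degree-sum P = begin
      ∑ I (λ j → ν P j * deg W (at P j))
        ≤⟨ ∑-mono I (λ {j} j∈ → ⟦⟧-*-mono (chord? P j) λ ch →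
             ≤-trans (flipped-degree P (∈-upTo⁻ j∈) ch) (+-monoʳ-≤ k (ℓ-flipped P (∈-upTo⁻ j∈) ch))) ⟩
      ∑ I (λ j → ν P j * (k + (κν j + g)))               ≡⟨ ∑-cong I (λ j → distrib (ν P j) k (κν j) g) ⟩
      ∑ I (λ j → ν P j * k + ν P j * κν j + ν P j * g)   ≡⟨ ≡.trans (∑-+ I _ _) (cong (_+ ∑ I (λ j → ν P j * g)) (∑-+ I _ _)) ⟩
      ∑ I (λ j → ν P j * k) + ∑ I (λ j → ν P j * κν j) + ∑ I (λ j → ν P j * g)
        ≡⟨ cong₂ (λ a b → a + ∑ I (λ j → ν P j * κν j) + b) (∑-*ʳ I k (ν P)) (∑-*ʳ I g (ν P)) ⟩
      ℓ P * k + ∑ I (λ j → ν P j * κν j) + ℓ P * g      ∎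
      where
      open ≤-Reasoning
      g = ∑ I (γ P)
      κν : ℕ → ℕ
      κν j = ∑ I (λ m → κ P j m * ν P m)
      distrib : ∀ a b d e → a * (b + (d + e)) ≡ a * b + a * d + a * e
      distrib = solve-∀

    -- The density hypothesis and the bound on outside degrees.

    module _ (β : ℕ)
             -- The number of edges meeting `T` is the degree sum over `T` minus half of `e₂ T`.
             -- Multiplied by 14, this says that it is at least `β / 7` times the size of `T`.
             (dense : ∀ (T : Fin n → ℕ) → (∀ u → T u ≤ W u) →
                      2 * β * ∑ V T + 7 * e₂ T ≤ 14 * ∑ V (λ u → T u * deg W u)) where

      -- The density hypothesis for the single vertex `x`.
      min-degree : ∀ {x} → W x ≡ 1 → β ≤ 7 * deg W x
      min-degree {x} Wx = *-cancelˡ-≤ 2 (begin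
        2 * β                              ≡⟨ *-identityʳ _ ⟨
        2 * β * 1                          ≡⟨ cong (2 * β *_) (∑-δ Fin._≟_ (allFin⁺ n) (∈-allFin x) (λ _ → 1)) ⟨
        2 * β * ∑ V (λ u → ⟦ x Fin.≟ u ⟧ * 1) ≡⟨ cong (2 * β *_) (∑-cong V (λ u → *-identityʳ _)) ⟩
        2 * β * ∑ V T                      ≤⟨ m≤m+n _ _ ⟩
        2 * β * ∑ V T + 7 * e₂ T           ≤⟨ dense T T≤W ⟩
        14 * ∑ V (λ u → T u * deg W u)     ≡⟨ cong (14 *_) (∑-δ Fin._≟_ (allFin⁺ n) (∈-allFin x) (deg W)) ⟩
        14 * deg W x                       ≡⟨ *-assoc 2 7 (deg W x) ⟩
        2 * (7 * deg W x)                  ∎)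
        where
        open ≤-Reasoning
        T : Fin n → ℕ
        T u = ⟦ x Fin.≟ u ⟧
        T≤W : ∀ u → T u ≤ W u
        T≤W u = ⟦⟧-≤ (x Fin.≟ u) λ { refl → ≤-reflexive (≡.sym Wx) }

      -- The density hypothesis for `T = L`. Distinctness of the vertices of `P` makes `T` an
      -- indicator function below `W`.
      dense-starts : ∀ P → 2 * β * ℓ P + 7 * inner P ≤ 14 * S P (deg W)
      dense-starts P = begin
        2 * β * ℓ P + 7 * inner P  ≡⟨ cong₂ (λ a b → 2 * β * a + 7 * b) ∑T e₂T ⟨
        2 * β * ∑ V T + 7 * e₂ T   ≤⟨ dense T T≤W ⟩
        14 * ∑ V (λ u → T u * deg W u) ≡⟨ cong (14 *_) (T-sum (deg W)) ⟩
        14 * S P (deg W)           ∎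
        where
        open ≤-Reasoning
        term : Fin n → ℕ → ℕ
        term u j = ν P j * ⟦ at P j Fin.≟ u ⟧
        T : Fin n → ℕ
        T u = ∑ I (term u)

        T-sum : ∀ F → ∑ V (λ u → T u * F u) ≡ S P F
        T-sum F = begin-equality
          ∑ V (λ u → T u * F u)              ≡⟨ ∑-cong V (λ u → ∑-*ʳ I (F u) (term u)) ⟨
          ∑ V (λ u → ∑ I (λ j → term u j * F u)) ≡⟨ ∑-swap V I _ ⟩
          ∑ I (λ j → ∑ V (λ u → term u j * F u))
            ≡⟨ ∑-cong I (λ j → ∑-cong V (λ u → *-assoc (ν P j) _ _)) ⟩
          ∑ I (λ j → ∑ V (λ u → ν P j * (⟦ at P j Fin.≟ u ⟧ * F u))) ≡⟨ ∑-cong I (λ j → ∑-*ˡ V (ν P j) _) ⟩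
          ∑ I (λ j → ν P j * ∑ V (λ u → ⟦ at P j Fin.≟ u ⟧ * F u))
            ≡⟨ ∑-cong I (λ j → cong (ν P j *_) (∑-δ Fin._≟_ (allFin⁺ n) (∈-allFin (at P j)) F)) ⟩
          S P F                              ∎

        ∑T : ∑ V T ≡ ℓ P
        ∑T = ≡.trans (∑-cong V (λ u → ≡.sym (*-identityʳ (T u))))
               (≡.trans (T-sum (λ _ → 1)) (∑-cong I (λ j → *-identityʳ (ν P j))))

        e₂T : e₂ T ≡ inner P
        e₂T = ≡.trans (T-sum (deg T)) (∑-cong I (λ j → cong (ν P j *_) (T-sum (α (at P j)))))

        T≤1 : ∀ u → T u ≤ 1
        T≤1 u = ∑-≤1 (upTo⁺ k) (λ j → *-mono-≤ (⟦⟧≤1 (chord? P j)) (⟦⟧≤1 (at P j Fin.≟ u)))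
          λ {i} {j} i∈ j∈ p q → inj P (<⇒≤ (∈-upTo⁻ i∈)) (<⇒≤ (∈-upTo⁻ j∈))
            (≡.trans (1≤⟦⟧ (at P i Fin.≟ u) (1≤*ʳ (ν P i) _ p)) (≡.sym (1≤⟦⟧ (at P j Fin.≟ u) (1≤*ʳ (ν P j) _ q))))

        T≤W : ∀ u → T u ≤ W u
        T≤W u with 1 ≤? T u
        ... | no ¬p = ≤-trans (≤-reflexive (≱1⇒≡0 ¬p)) z≤n
        ... | yes p with j , j∈ , q ← ∑-pos I p with 1≤⟦⟧ (at P j Fin.≟ u) (1≤*ʳ (ν P j) _ q)
        ...   | refl = ≤-trans (T≤1 u) (≤-reflexive (≡.sym (inW P (<⇒≤ (∈-upTo⁻ j∈)))))

      -- The negation of the final estimate `7β ≤ 63k + 21` in `no-optimal-path`.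
      module _ (9k+3<β : 9 * k + 3 < β) where

        β≤7k+7ℓ : ∀ P → β ≤ 7 * k + 7 * ℓ P
        β≤7k+7ℓ P = ≤-trans (min-degree {at P 0} (inW P z≤n))
          (≤-trans (*-monoʳ-≤ 7 (deg-start P)) (≤-reflexive (*-distribˡ-+ 7 k (ℓ P))))

        -- Needed to cancel the factor `ℓ P` below. Without chords the start would have degree at
        -- most `k`, too little for `min-degree`.
        0<ℓ : ∀ P → 0 < ℓ P
        0<ℓ P = n≢0⇒n>0 λ ℓ≡0 → <⇒≱ 9k+3<β (begin
          β                ≤⟨ β≤7k+7ℓ P ⟩
          7 * k + 7 * ℓ P  ≡⟨ cong (λ x → 7 * k + 7 * x) ℓ≡0 ⟩
          7 * k + 0        ≤⟨ +-mono-≤ (*-monoˡ-≤ k (m≤m+n 7 2)) z≤n ⟩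
          9 * k + 3        ∎)
          where open ≤-Reasoning

        -- Density of `L` gives `2β ≤ 14k + 7l + 7 + 14g`. Adding `β ≤ 7k + 7l` makes the
        -- coefficients of `l` and `g` both 14, so `l + a + g ≤ k` removes them. For `β = 9k + 14`
        -- the result is `14a ≤ 8k − 35`.
        outdeg-bound : ∀ P → 14 * outdeg P + 3 * β ≤ 35 * k + 7
        outdeg-bound P = *-cancelˡ-≤ l {{>-nonZero (0<ℓ P)}} (begin
          l * (14 * a + 3 * β)                      ≡⟨ expand₁ l a β ⟩
          2 * β * l + l * (14 * a + β)              ≤⟨ +-mono-≤ 2βl≤ (*-monoʳ-≤ l (+-monoʳ-≤ (14 * a) (β≤7k+7ℓ P))) ⟩
          l * (14 * k + 7 * l + 7 + 14 * g) + l * (14 * a + (7 * k + 7 * l)) ≡⟨ expand₂ l k g a ⟩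
          l * (14 * (l + a + g) + (21 * k + 7))     ≤⟨ *-monoʳ-≤ l (+-monoˡ-≤ (21 * k + 7) (*-monoʳ-≤ 14 l+a+g≤k)) ⟩
          l * (14 * k + (21 * k + 7))               ≡⟨ expand₃ l k ⟩
          l * (35 * k + 7)                          ∎)
          where
          open ≤-Reasoning
          l = ℓ P
          a = outdeg P
          g = ∑ I (γ P)
          E′ = inner P
          K = ∑ I (λ j → ν P j * ∑ I (λ m → κ P j m * ν P m))

          l+a+g≤k : l + a + g ≤ k
          l+a+g≤k = ≤-trans (+-monoˡ-≤ g (+-monoʳ-≤ l (outdeg≤∑ω P))) (∑ν+ω+γ P)

          2βl≤ : 2 * β * l ≤ l * (14 * k + 7 * l + 7 + 14 * g)
          -- Edges inside `L` enter `dense-starts` and `chord-pairs` with equal weight and cancel.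
          2βl≤ = +-cancelʳ-≤ (7 * E′) _ _ (begin
            2 * β * l + 7 * E′                       ≤⟨ dense-starts P ⟩
            14 * S P (deg W)                         ≤⟨ *-monoʳ-≤ 14 (degree-sum P) ⟩
            14 * (l * k + K + l * g)                 ≡⟨ expand₄ l k K g ⟩
            14 * (l * k + l * g) + 7 * (2 * K)       ≤⟨ +-monoʳ-≤ (14 * (l * k + l * g)) (*-monoʳ-≤ 7 (chord-pairs P)) ⟩
            14 * (l * k + l * g) + 7 * (E′ + (l * l + l)) ≡⟨ expand₅ l k g E′ ⟩
            l * (14 * k + 7 * l + 7 + 14 * g) + 7 * E′ ∎)
            where
            expand₄ : ∀ l k K g → 14 * (l * k + K + l * g) ≡ 14 * (l * k + l * g) + 7 * (2 * K)
            expand₄ = solve-∀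
            expand₅ : ∀ l k g e → 14 * (l * k + l * g) + 7 * (e + (l * l + l)) ≡
                                  l * (14 * k + 7 * l + 7 + 14 * g) + 7 * e
            expand₅ = solve-∀

          expand₁ : ∀ l a β → l * (14 * a + 3 * β) ≡ 2 * β * l + l * (14 * a + β)
          expand₁ = solve-∀
          expand₂ : ∀ l k g a → l * (14 * k + 7 * l + 7 + 14 * g) + l * (14 * a + (7 * k + 7 * l)) ≡
                                l * (14 * (l + a + g) + (21 * k + 7))
          expand₂ = solve-∀
          expand₃ : ∀ l k → l * (14 * k + (21 * k + 7)) ≡ l * (35 * k + 7)
          expand₃ = solve-∀

        -- Degrees of last vertices, and the contradiction from a path with most chords.

        deg-end : ∀ (P R : Path) → (∀ {u} → On R u → On P u) →
                  deg W (at R k) ≤ outdeg R + (∑ I (λ p → α (at R k) (at P p)) + 1)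
        deg-end P R on = begin
          deg W y                                      ≤⟨ ∑-mono V (λ {u} _ → pointwise u) ⟩
          -- `I` stops at `k − 1`, so the vertex `at P k` gets a summand of its own.
          ∑ V (λ u → out R u + (∑ I (term u) + ⟦ at P k Fin.≟ u ⟧))
            ≡⟨ ≡.trans (∑-+ V _ _) (cong (outdeg R +_) (∑-+ V _ _)) ⟩
          outdeg R + (∑ V (λ u → ∑ I (term u)) + ∑ V (λ u → ⟦ at P k Fin.≟ u ⟧))
            ≤⟨ +-monoʳ-≤ (outdeg R) (+-mono-≤
                 (≤-trans (≤-reflexive (∑-swap V I term)) (∑-mono I (λ {p} _ → term-≤ p)))
                 (at-most-one (at P k))) ⟩
          outdeg R + (∑ I (λ p → α y (at P p)) + 1)    ∎
          where
          open ≤-Reasoning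
          y = at R k
          term : Fin n → ℕ → ℕ
          term u p = α y (at P p) * ⟦ at P p Fin.≟ u ⟧

          at-most-one : ∀ x → ∑ V (λ u → ⟦ x Fin.≟ u ⟧) ≤ 1
          at-most-one x = ∑-≤1 (allFin⁺ n) (λ u → ⟦⟧≤1 (x Fin.≟ u))
            λ {u} {v} _ _ p q → ≡.trans (≡.sym (1≤⟦⟧ (x Fin.≟ u) p)) (1≤⟦⟧ (x Fin.≟ v) q)

          term-≤ : ∀ p → ∑ V (λ u → term u p) ≤ α y (at P p)
          term-≤ p = begin
            ∑ V (λ u → term u p)                                   ≡⟨ ∑-*ˡ V (α y (at P p)) _ ⟩
            α y (at P p) * ∑ V (λ u → ⟦ at P p Fin.≟ u ⟧)  ≤⟨ *-monoʳ-≤ (α y (at P p)) (at-most-one (at P p)) ⟩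
            α y (at P p) * 1                                       ≡⟨ *-identityʳ _ ⟩
            α y (at P p)                                           ∎

          covered : ∀ u → W u ≡ 1 → E G y u → 1 ≤ out R u + (∑ I (term u) + ⟦ at P k Fin.≟ u ⟧)
          covered u Wu e with on? R u
          ... | no u∉R rewrite Wu | ⟦⟧≡1 (E? y u) e = s≤s z≤n
          ... | yes u∈R with on u∈R
          ...   | p , s≤s p≤k , refl with m≤n⇒m<n∨m≡n p≤k
          ...     | inj₂ refl = ≤-trans (≤-reflexive (≡.sym (⟦⟧≡1 (at P k Fin.≟ at P k) refl)))
            (≤-trans (m≤n+m _ (∑ I (term u))) (m≤n+m _ (W u * (α y u * 0))))
          ...     | inj₁ p<k = ≤-trans
            (≤-reflexive (≡.sym (cong₂ _*_ (⟦⟧≡1 (E? y u) e) (⟦⟧≡1 (at P p Fin.≟ u) refl))))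
            (≤-trans (∈-≤-∑ {f = term u} (∈-upTo⁺ p<k)) (≤-trans (m≤m+n _ _) (m≤n+m _ (W u * (α y u * 0)))))

          pointwise : ∀ u → W u * α y u ≤ out R u + (∑ I (term u) + ⟦ at P k Fin.≟ u ⟧)
          pointwise u = ≤1-* (W≤1 u) λ Wu → ⟦⟧-≤ (E? y u) (covered u Wu)

        -- The `k − ℓ P` positions outside `L` contribute at most 1 each.
        neighbours-on-path : ∀ (P : Path) x → ∑ I (λ p → α x (at P p)) + ℓ P ≤ k + S P (α x)
        neighbours-on-path P x = begin
          ∑ I (λ p → α x (at P p)) + ℓ P            ≡⟨ ∑-+ I _ _ ⟨
          ∑ I (λ p → α x (at P p) + ν P p)          ≤⟨ ∑-mono I (λ {p} _ → pointwise p) ⟩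
          ∑ I (λ p → 1 + ν P p * α x (at P p))      ≡⟨ ∑-+ I _ _ ⟩
          ∑ I (λ _ → 1) + S P (α x)
            ≡⟨ cong (_+ S P (α x)) ∑1≡k ⟩
          k + S P (α x)                             ∎
          where
          open ≤-Reasoning
          pointwise : ∀ p → α x (at P p) + ν P p ≤ 1 + ν P p * α x (at P p)
          pointwise p with chord? P p
          ... | yes _ = ≤-reflexive (≡.trans (+-comm _ 1) (cong suc (≡.sym (*-identityˡ _))))
          ... | no _ = ≤-trans (≤-reflexive (+-identityʳ _)) (⟦⟧≤1 (E? x (at P p)))

        -- Reversing the flipped path makes `vⱼ` a last vertex. Then `outdeg-bound` limits its
        -- neighbours off the path and `neighbours-on-path` those on it.
        deg-flip-start : ∀ P {j} → j < k → Chord P j →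
          14 * deg W (at P j) + (3 * β + 14 * ℓ P) ≤ 14 * S P (α (at P j)) + (49 * k + 21)
        deg-flip-start P {j} j<k ch = begin
          14 * deg W x + (3 * β + 14 * l)   ≤⟨ +-monoˡ-≤ (3 * β + 14 * l) (*-monoʳ-≤ 14 deg≤) ⟩
          14 * (a + (b + 1)) + (3 * β + 14 * l)   ≡⟨ regroup₁ a b β l ⟩
          (14 * a + 3 * β) + (14 * (b + l) + 14)
            ≤⟨ +-mono-≤ (outdeg-bound K.flip) (+-monoˡ-≤ 14 (*-monoʳ-≤ 14 (neighbours-on-path P x))) ⟩
          (35 * k + 7) + (14 * (k + s) + 14)      ≡⟨ regroup₂ k s ⟩
          14 * s + (49 * k + 21)                  ∎
          where
          open ≤-Reasoning
          module J = Rotate W P j<k ch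
          module K = Reverse W J.flip
          x = at P j
          l = ℓ P
          a = outdeg K.flip
          b = ∑ I (λ p → α x (at P p))
          s = S P (α x)
          end : at K.flip k ≡ x
          end = ≡.trans (cong (at J.flip) (≡.trans (K.turn-lo ≤-refl) (n∸n≡0 k))) J.flip-start
          deg≤ : deg W x ≤ a + (b + 1)
          deg≤ = subst (λ y → deg W y ≤ a + (∑ I (λ p → α y (at P p)) + 1)) end
                   (deg-end P K.flip (J.on-flip ∘ K.on-flip))
          regroup₁ : ∀ a b β l → 14 * (a + (b + 1)) + (3 * β + 14 * l) ≡ (14 * a + 3 * β) + (14 * (b + l) + 14)
          regroup₁ = solve-∀
          regroup₂ : ∀ k s → (35 * k + 7) + (14 * (k + s) + 14) ≡ 14 * s + (49 * k + 21)
          regroup₂ = solve-∀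

        -- Add `dense-starts` twice, `by-places` once and `s≤` 14 times: the degree sum `s`, the
        -- edges inside `L` and the squares of `l` cancel, which leaves `7β ≤ 63k + 21` after
        -- division by `l`. Optimality enters through `s≤`.
        no-optimal-path : ∀ P → (∀ (Q : Path) → ℓ Q ≤ ℓ P) → ⊥
        no-optimal-path P optimal = <⇒≱ 9k+3<β (*-cancelˡ-≤ 7 (≤-trans 7β≤ (≤-reflexive (expand k))))
          where
          open ≤-Reasoning
          l = ℓ P
          s = S P (deg W)
          E′ = inner P
          expand : ∀ k → 63 * k + 21 ≡ 7 * (9 * k + 3)
          expand = solve-∀

          S-+ : ∀ F b → ∑ I (λ j → ν P j * (14 * F (at P j) + b)) ≡ 14 * S P F + l * b
          S-+ F b = ≡.trans (∑-cong I (λ j → distrib (ν P j) (F (at P j)) b))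
            (≡.trans (∑-+ I _ _) (cong₂ _+_ (∑-*ˡ I 14 _) (∑-*ʳ I b (ν P))))
            where
            distrib : ∀ a x b → a * (14 * x + b) ≡ 14 * (a * x) + a * b
            distrib = solve-∀

          s≤ : s ≤ l * (k + l)
          s≤ = ≤-trans (∑-mono I λ {j} j∈ → ⟦⟧-*-mono (chord? P j) λ ch →
                 ≤-trans (flipped-degree P (∈-upTo⁻ j∈) ch) (+-monoʳ-≤ k (optimal (Rotate.flip W P (∈-upTo⁻ j∈) ch))))
                 (≤-reflexive (∑-*ʳ I (k + l) (ν P)))

          by-places : 14 * s + l * (3 * β + 14 * l) ≤ 14 * E′ + l * (49 * k + 21)
          by-places = begin
            14 * s + l * (3 * β + 14 * l)                                    ≡⟨ S-+ (deg W) _ ⟨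
            ∑ I (λ j → ν P j * (14 * deg W (at P j) + (3 * β + 14 * l)))
              ≤⟨ ∑-mono I (λ {j} j∈ → ⟦⟧-*-mono (chord? P j) (deg-flip-start P (∈-upTo⁻ j∈))) ⟩
            ∑ I (λ j → ν P j * (14 * S P (α (at P j)) + (49 * k + 21)))      ≡⟨ S-+ (λ x → S P (α x)) _ ⟩
            14 * E′ + l * (49 * k + 21)                                      ∎

          7β≤ : 7 * β ≤ 63 * k + 21
          7β≤ = *-cancelˡ-≤ l {{>-nonZero (0<ℓ P)}} (+-cancelʳ-≤ (14 * E′ + 14 * s + 14 * (l * l)) _ _ (begin
            l * (7 * β) + (14 * E′ + 14 * s + 14 * (l * l))                ≡⟨ regroup₁ l β E′ s ⟩
            2 * (2 * β * l + 7 * E′) + (14 * s + l * (3 * β + 14 * l))     ≤⟨ +-mono-≤ (*-monoʳ-≤ 2 (dense-starts P)) by-places ⟩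
            2 * (14 * s) + (14 * E′ + l * (49 * k + 21))                   ≡⟨ regroup₂ s E′ l k ⟩
            14 * s + (14 * s + (14 * E′ + l * (49 * k + 21)))
              ≤⟨ +-monoˡ-≤ (14 * s + (14 * E′ + l * (49 * k + 21))) (*-monoʳ-≤ 14 s≤) ⟩
            14 * (l * (k + l)) + (14 * s + (14 * E′ + l * (49 * k + 21)))  ≡⟨ regroup₃ l k s E′ ⟩
            l * (63 * k + 21) + (14 * E′ + 14 * s + 14 * (l * l))          ∎))
            where
            regroup₁ : ∀ l β e s → l * (7 * β) + (14 * e + 14 * s + 14 * (l * l)) ≡
                                   2 * (2 * β * l + 7 * e) + (14 * s + l * (3 * β + 14 * l))
            regroup₁ = solve-∀
            regroup₂ : ∀ s e l k → 2 * (14 * s) + (14 * e + l * (49 * k + 21)) ≡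
                                   14 * s + (14 * s + (14 * e + l * (49 * k + 21)))
            regroup₂ = solve-∀
            regroup₃ : ∀ l k s e → 14 * (l * (k + l)) + (14 * s + (14 * e + l * (49 * k + 21))) ≡
                                   l * (63 * k + 21) + (14 * e + 14 * s + 14 * (l * l))
            regroup₃ = solve-∀

        ℓ≤k : ∀ P → ℓ P ≤ k
        ℓ≤k P = ≤-trans (∑-mono I (λ {j} _ → ⟦⟧≤1 (chord? P j)))
          (≤-reflexive ∑1≡k)

        -- The number of chords is at most `k`, so it cannot be improved forever: `s` bounds
        -- `k − ℓ P` and drops with each better path.
        no-path : ¬ Path
        no-path P = go k P (m≤n+m k (ℓ P))
          where
          go : ∀ s P → k ≤ ℓ P + s → ⊥
          go zero P k≤ = no-optimal-path P λ Q →
            ≤-trans (ℓ≤k Q) (subst (k ≤_) (+-identityʳ (ℓ P)) k≤)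
          go (suc s) P k≤ = no-optimal-path P λ Q → ≮⇒≥ λ ℓP<ℓQ →
            go s Q (≤-trans k≤ (≤-trans (≤-reflexive (+-suc (ℓ P) s)) (+-monoˡ-≤ s ℓP<ℓQ)))

  -- Reduction to a minimal dense vertex set.

  β : ℕ → ℕ
  β k = 9 * k + 14

  -- `B W W` unfolds to `e₂ W` and `B T W` to the degree sum over `T`, so both obey bilinearity and
  -- symmetry.
  B : (Fin n → ℕ) → (Fin n → ℕ) → ℕ
  B X Y = ∑ V (λ x → X x * ∑ V (λ u → Y u * α x u))

  B-sym : ∀ X Y → B X Y ≡ B Y X
  B-sym X Y = begin
    ∑ V (λ x → X x * ∑ V (λ u → Y u * α x u))    ≡⟨ ∑-cong V (λ x → ∑-*ˡ V (X x) _) ⟨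
    ∑ V (λ x → ∑ V (λ u → X x * (Y u * α x u)))  ≡⟨ ∑-swap V V _ ⟩
    ∑ V (λ u → ∑ V (λ x → X x * (Y u * α x u)))  ≡⟨ ∑-cong V (λ u → ∑-cong V (λ x → swap x u)) ⟩
    ∑ V (λ u → ∑ V (λ x → Y u * (X x * α u x)))  ≡⟨ ∑-cong V (λ u → ∑-*ˡ V (Y u) _) ⟩
    ∑ V (λ u → Y u * ∑ V (λ x → X x * α u x))    ∎
    where
    open ≡.≡-Reasoning
    exchange : ∀ a b d → a * (b * d) ≡ b * (a * d)
    exchange = solve-∀
    swap : ∀ x u → X x * (Y u * α x u) ≡ Y u * (X x * α u x)
    swap x u = ≡.trans (exchange (X x) (Y u) (α x u)) (cong (λ e → Y u * (X x * e)) (α-sym x u))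

  B-+ˡ : ∀ W X X′ → (∀ u → W u ≡ X u + X′ u) → ∀ Y → B W Y ≡ B X Y + B X′ Y
  B-+ˡ W X X′ eq Y = ≡.trans
    (∑-cong V (λ x → ≡.trans (cong (_* Yα x) (eq x)) (*-distribʳ-+ (Yα x) (X x) (X′ x))))
    (∑-+ V _ _)
    where
    Yα : Fin n → ℕ
    Yα x = ∑ V (λ u → Y u * α x u)

  B-+ʳ : ∀ W X X′ → (∀ u → W u ≡ X u + X′ u) → ∀ Y → B Y W ≡ B Y X + B Y X′
  B-+ʳ W X X′ eq Y =
    ≡.trans (B-sym Y W) (≡.trans (B-+ˡ W X X′ eq Y) (cong₂ _+_ (B-sym X Y) (B-sym X′ Y)))

  -- Removing `T` destroys exactly the edges meeting `T`, and twice their number is `2 * B T W`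
  -- minus `e₂ T`.
  e₂-split : ∀ {W T U} → (∀ u → W u ≡ T u + U u) → e₂ W + e₂ T ≡ 2 * B T W + e₂ U
  e₂-split {W} {T} {U} eq = begin
    B W W + B T T                      ≡⟨ cong (_+ B T T) (B-+ˡ W T U eq W) ⟩
    B T W + B U W + B T T              ≡⟨ cong (λ b → B T W + b + B T T) (B-+ʳ W T U eq U) ⟩
    B T W + (B U T + B U U) + B T T    ≡⟨ cong (λ b → B T W + (b + B U U) + B T T) (B-sym U T) ⟩
    B T W + (B T U + B U U) + B T T    ≡⟨ regroup (B T W) (B T U) (B U U) (B T T) ⟩
    B T W + (B T T + B T U) + B U U    ≡⟨ cong (λ b → B T W + b + B U U) (B-+ʳ W T U eq T) ⟨
    B T W + B T W + B U U              ≡⟨ cong (_+ B U U) (double (B T W)) ⟨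
    2 * B T W + B U U                  ∎
    where
    open ≡.≡-Reasoning
    regroup : ∀ a b d e → a + (b + d) + e ≡ a + (e + b) + d
    regroup = solve-∀
    double : ∀ a → 2 * a ≡ a + a
    double = solve-∀

  e₂-empty : ∀ {W} → ∑ V W ≡ 0 → e₂ W ≡ 0
  e₂-empty {W} ∑W≡0 = ∑-zero V λ {x} x∈ →
    cong (_* deg W x) (n≤0⇒n≡0 (≤-trans (∈-≤-∑ x∈) (≤-reflexive ∑W≡0)))

  restrict : ∀ {W U : Fin n → ℕ} {k} → (∀ {u} → U u ≡ 1 → W u ≡ 1) →
             RainbowPath U k → RainbowPath W k
  restrict U⇒W P = record { at = at ; inj = inj ; edge = edge ; inW = U⇒W ∘ inW ; hue-inj = hue-inj }
    where open RainbowPath P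

  trivial-path : ∀ {W : Fin n → ℕ} {x} → W x ≡ 1 → RainbowPath W 0
  trivial-path {x = x} Wx = record
    { at = λ _ → x ; inj = λ { z≤n z≤n _ → refl } ; edge = λ () ; inW = λ _ → Wx ; hue-inj = λ () }

  Sparse : ℕ → (Fin n → ℕ) → Set
  Sparse k W = 7 * e₂ W < 2 * β k * ∑ V W

  -- In a set that is not sparse although all its smaller subsets are, removing any T
  -- destroys many edges; this is the hypothesis under which paths are analysed above.
  minimal⇒no-path : ∀ k W → (∀ u → W u ≤ 1) → ¬ RainbowPath W (suc k) →
    (∀ U → (∀ u → U u ≤ W u) → 1 ≤ ∑ V U → ∑ V U < ∑ V W → Sparse k U) →
    2 * β k * ∑ V W ≤ 7 * e₂ W → ¬ RainbowPath W k
  minimal⇒no-path k W W≤1 maximal smaller heavy =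
    -- `m≤m+n 4 10` serves as `3 < 14`.
    no-path W W≤1 k maximal (β k) dense (+-monoʳ-< (9 * k) (m≤m+n 4 10))
    where
    open ≤-Reasoning
    dense : ∀ (T : Fin n → ℕ) → (∀ u → T u ≤ W u) →
            2 * β k * ∑ V T + 7 * e₂ T ≤ 14 * B T W
    dense T T≤W with 1 ≤? ∑ V T
    -- For empty `T` the complement is all of `W`, which `smaller` does not cover.
    ... | no T≡∅ rewrite e₂-empty {T} (≱1⇒≡0 T≡∅) | ≱1⇒≡0 T≡∅ | *-zeroʳ (2 * β k) = z≤n
    ... | yes 1≤T = +-cancelʳ-≤ (7 * e₂ U) _ _ (begin
      2 * β k * ∑ V T + 7 * e₂ T + 7 * e₂ U    ≤⟨ +-monoʳ-≤ (2 * β k * ∑ V T + 7 * e₂ T) U-sparse ⟩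
      2 * β k * ∑ V T + 7 * e₂ T + 2 * β k * ∑ V U ≡⟨ regroup₁ (2 * β k) (∑ V T) (e₂ T) (∑ V U) ⟩
      2 * β k * (∑ V T + ∑ V U) + 7 * e₂ T     ≡⟨ cong (λ m → 2 * β k * m + 7 * e₂ T) ∑W ⟨
      2 * β k * ∑ V W + 7 * e₂ T               ≤⟨ +-monoˡ-≤ (7 * e₂ T) heavy ⟩
      7 * e₂ W + 7 * e₂ T                      ≡⟨ *-distribˡ-+ 7 (e₂ W) (e₂ T) ⟨
      7 * (e₂ W + e₂ T)                        ≡⟨ cong (7 *_) (e₂-split {W} {T} {U} W≡T+U) ⟩
      7 * (2 * B T W + e₂ U)                   ≡⟨ regroup₂ (B T W) (e₂ U) ⟩
      14 * B T W + 7 * e₂ U                    ∎)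
      where
      U : Fin n → ℕ
      U u = W u ∸ T u
      W≡T+U : ∀ u → W u ≡ T u + U u
      W≡T+U u = ≡.sym (m+[n∸m]≡n (T≤W u))
      ∑W : ∑ V W ≡ ∑ V T + ∑ V U
      ∑W = ≡.trans (∑-cong V W≡T+U) (∑-+ V T U)
      U-sparse : 7 * e₂ U ≤ 2 * β k * ∑ V U
      U-sparse with 1 ≤? ∑ V U
      -- The strict inequality of `Sparse` fails for the empty set; the weak one holds.
      ... | no U≡∅ rewrite e₂-empty {U} (≱1⇒≡0 U≡∅) = z≤n
      ... | yes 1≤U = <⇒≤ (smaller U (λ u → m∸n≤m (W u) (T u)) 1≤U
                             (≤-trans (+-monoˡ-≤ (∑ V U) 1≤T) (≤-reflexive (≡.sym ∑W))))
      regroup₁ : ∀ b t e u → b * t + 7 * e + b * u ≡ b * (t + u) + 7 * e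
      regroup₁ = solve-∀
      regroup₂ : ∀ b e → 7 * (2 * b + e) ≡ 14 * b + 7 * e
      regroup₂ = solve-∀

  -- Induction on the size bound `s` and on `k`. If `W` is not sparse, its smaller subsets still
  -- are, so it has no rainbow path with `k` edges. For `k = 0` any vertex of `W` contradicts this;
  -- otherwise `W` is sparse for `k − 1` by recursion, although `β` increases with `k`.
  sparse : ∀ k s W → (∀ u → W u ≤ 1) → 1 ≤ ∑ V W → ∑ V W ≤ s → ¬ RainbowPath W (suc k) → Sparse k W
  sparse k zero W W≤1 1≤W W≤s maximal = contradiction (≤-trans 1≤W W≤s) λ ()
  sparse k (suc s) W W≤1 1≤W W≤s maximal = ≰⇒> λ heavy →
    shorter k heavy (minimal⇒no-path k W W≤1 maximal smaller heavy)
    where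
    smaller : ∀ U → (∀ u → U u ≤ W u) → 1 ≤ ∑ V U → ∑ V U < ∑ V W → Sparse k U
    smaller U U≤W 1≤U U<W = sparse k s U (λ u → ≤-trans (U≤W u) (W≤1 u)) 1≤U
      (≤-pred (≤-trans U<W W≤s))
      (maximal ∘ restrict λ {u} Uu → ≤-antisym (W≤1 u) (≤-trans (≤-reflexive (≡.sym Uu)) (U≤W u)))

    shorter : ∀ k → 2 * β k * ∑ V W ≤ 7 * e₂ W → ¬ ¬ RainbowPath W k
    shorter zero heavy no-path₀ with x , _ , p ← ∑-pos V 1≤W =
      no-path₀ (trivial-path (≤-antisym (W≤1 x) p))
    shorter (suc k) heavy no-pathₖ = <⇒≱ (sparse k (suc s) W W≤1 1≤W W≤s no-pathₖ)
      (≤-trans (*-monoˡ-≤ (∑ V W) (*-monoʳ-≤ 2 (+-monoˡ-≤ 14 (*-monoʳ-≤ 9 (n≤1+n k))))) heavy)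

  -- Translation to `edgeCount` and `PathCopy`, and the final bound.

  2*edgeCount≤e₂ : 2 * edgeCount G ≤ e₂ (λ _ → 1)
  2*edgeCount≤e₂ = begin
    2 * ∑ V (λ u → ∑ V (f u))                       ≡⟨ double (∑ V (λ u → ∑ V (f u))) ⟩
    ∑ V (λ u → ∑ V (f u)) + ∑ V (λ u → ∑ V (f u))   ≡⟨ cong (∑ V (λ u → ∑ V (f u)) +_) (∑-swap V V f) ⟩
    ∑ V (λ u → ∑ V (f u)) + ∑ V (λ u → ∑ V (λ v → f v u)) ≡⟨ ∑-+ V _ _ ⟨
    ∑ V (λ u → ∑ V (f u) + ∑ V (λ v → f v u))       ≡⟨ ∑-cong V (λ u → ∑-+ V _ _) ⟨
    ∑ V (λ u → ∑ V (λ v → f u v + f v u))           ≤⟨ ∑-mono V (λ {u} _ → ∑-mono V (λ {v} _ → once u v)) ⟩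
    ∑ V (λ u → ∑ V (α u))
      ≡⟨ ∑-cong V (λ u → ≡.trans (*-identityˡ _) (∑-cong V (λ v → *-identityˡ (α u v)))) ⟨
    e₂ (λ _ → 1)                                    ∎
    where
    open ≤-Reasoning
    double : ∀ a → 2 * a ≡ a + a
    double = solve-∀
    f : Fin n → Fin n → ℕ
    f u v = if adj G u v ∧ (toℕ u <ᵇ toℕ v) then 1 else 0

    -- An edge is counted only from its smaller endpoint, so `f u v` and `f v u` are never both 1.
    once : ∀ u v → f u v + f v u ≤ α u v
    once u v rewrite sym G v u with adj G u v
    ... | false = z≤n
    ... | true with toℕ u <ᵇ toℕ v in u<v | toℕ v <ᵇ toℕ u in v<u
    ...   | false | false = z≤n
    ...   | false | true  = ≤-refl
    ...   | true  | false = ≤-refl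
    ...   | true  | true  = contradiction
      (<ᵇ⇒< (toℕ v) (toℕ u) (subst IsTrue (≡.sym v<u) _))
      (<-asym (<ᵇ⇒< (toℕ u) (toℕ v) (subst IsTrue (≡.sym u<v) _)))

  path-copy : ∀ {W : Fin n → ℕ} {k} (P : RainbowPath W k) → ∃ λ (Q : PathCopy G k) → Rainbow c Q
  path-copy P = Q , λ i j eq → Fin.toℕ-injective
    (hue-inj (Fin.toℕ<n i) (Fin.toℕ<n j) (≡.trans (≡.sym (hue-≡ i)) (≡.trans eq (hue-≡ j))))
    where
    open RainbowPath P
    Q : PathCopy G _
    Q = record
      { vtx = λ i → at (toℕ i)
      ; injective = λ i j eq → Fin.toℕ-injective (inj (Fin.toℕ≤pred[n] i) (Fin.toℕ≤pred[n] j) eq)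
      ; edges = λ i → subst (λ m → E G (at m) (at (suc (toℕ i)))) (≡.sym (Fin.toℕ-inject₁ i)) (edge (Fin.toℕ<n i)) }
    hue-≡ : ∀ i → pathEdgeColor c Q i ≡ hue (toℕ i)
    hue-≡ i = cong (λ m → col c (at m) (at (suc (toℕ i)))) (Fin.toℕ-inject₁ i)

theorem2 : ∀ (k n : ℕ) → 1 ≤ k → 1 ≤ n →
    (G : Graph n) (c : ProperColoring G) → NoRainbowPath c (suc k) →
    7 * edgeCount G < (9 * k + 14) * n
theorem2 k n _ 1≤n G c no-rainbow = *-cancelˡ-< 2 _ _ (begin-strict
  2 * (7 * edgeCount G)          ≡⟨ exchange (edgeCount G) ⟩
  7 * (2 * edgeCount G)          ≤⟨ *-monoʳ-≤ 7 (2*edgeCount≤e₂ G c) ⟩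
  -- `sparse` for the set of all vertices, with its size `n` as the bound.
  7 * e₂ G c (λ _ → 1)           <⟨ sparse G c k n (λ _ → 1) (λ _ → ≤-refl)
    (≤-trans 1≤n (≤-reflexive (≡.sym size))) (≤-reflexive size)
    (λ P → let Q , rainbow = path-copy G c P in no-rainbow Q rainbow) ⟩
  2 * (9 * k + 14) * ∑ (allFin n) (λ _ → 1) ≡⟨ cong (2 * (9 * k + 14) *_) size ⟩
  2 * (9 * k + 14) * n           ≡⟨ *-assoc 2 (9 * k + 14) n ⟩
  2 * ((9 * k + 14) * n)         ∎)
  where
  open ≤-Reasoning
  size : ∑ (allFin n) (λ _ → 1) ≡ n
  size = ≡.trans (∑-const (allFin n) 1) (≡.trans (*-identityʳ _) (length-tabulate {n = n} (λ i → i)))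
  exchange : ∀ e → 2 * (7 * e) ≡ 7 * (2 * e)
  exchange = solve-∀
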